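{- $\mathbf{JID}$ is a discriminator variety of level $2$; that is, $\mathbf{JID}$ is a discriminator variety and $\mathbf{JID}\subseteq\mathbf{DQD_2}$.
   Context: A semi-Heyting algebra is an algebra $\langle L,\vee,\wedge,\to,0,1\rangle$ such that $\langle L,\vee,\wedge,0,1\rangle$ is a bounded lattice and the identities $x\wedge(x\to y)\approx x\wedge y$, $x\wedge(y\to z)\approx x\wedge[(x\wedge y)\to(x\wedge z)]$, $x\to x\approx 1$ hold; write $x^*:=x\to 0$. A $\mathbf{DQD}$-algebra (dually quasi-De Morgan semi-Heyting algebra) is an algebra $\langle L,\vee,\wedge,\to,{}',0,1\rangle$ whose reduct $\langle L,\vee,\wedge,\to,0,1\rangle$ is a semi-Heyting algebra and which satisfies: $0'\approx 1$ and $1'\approx 0$; $(x\wedge y)'\approx x'\vee y'$; $(x\vee y)''\approx x''\vee y''$; $x''\le x$. $\mathbf{DQD}$ denotes the variety of all $\mathbf{DQD}$-algebras. $\mathbf{JID}$ is the subvariety of $\mathbf{DQD}$ defined by $x'\vee(y\to z)\approx(x'\vee y)\to(x'\vee z)$. Levels: put $x^{(0)}:=x$ and $x^{(n+1)}:=((x^{(n)})')^*$; put $t_0(x):=x$ and $t_{n+1}(x):=t_n(x)\wedge x^{(n+1)}$. $\mathbf{DQD_n}$ is the subvariety of $\mathbf{DQD}$ defined by $t_n(x)\approx t_{n+1}(x)$. A discriminator variety is one generated by a class of algebras on all of which a single ternary term $t$ represents the discriminator function ($t(x,x,z)=z$ and $t(x,y,z)=x$ if $x\ne y$). -}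

module Defs where

open import Level using (Level; _⊔_; 0ℓ) renaming (suc to lsuc)
open import Algebra.Core using (Op₁; Op₂)
import Algebra.Definitions as AlgDefs
open import Algebra.Lattice.Structures using (IsLattice)
open import Data.Fin.Base using (Fin)
open import Data.Nat.Base using (ℕ; zero; suc)
open import Data.Product.Base using (_×_; _,_; Σ-syntax)
open import Data.Vec.Base using (lookup; _∷_; [])
open import Function.Bundles using (_⇔_)
open import Relation.Binary.Core using (Rel)
open import Relation.Binary.Structures using (IsEquivalence)
open import Relation.Nullary.Negation.Core using (¬_)
open import Relation.Unary using (Pred)

-- Arbitrary algebras of type ⟨∨, ∧, →, ′, 0, 1⟩.  The underlying set is a
-- setoid, so every operation has to respect its equality.
record Algebra (c ℓ : Level) : Set (lsuc (c ⊔ ℓ)) where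
  infix  4 _≈_ _≤_
  infixr 5 _⇒_
  infixr 6 _∨_
  infixr 7 _∧_
  infix  8 _′ _*

  field
    Carrier       : Set c
    _≈_           : Rel Carrier ℓ
    _∨_ _∧_ _⇒_   : Op₂ Carrier
    _′            : Op₁ Carrier
    𝟘 𝟙           : Carrier
    isEquivalence : IsEquivalence _≈_

  open AlgDefs _≈_ using (Congruent₁; Congruent₂)

  field
    ∨-cong : Congruent₂ _∨_
    ∧-cong : Congruent₂ _∧_
    ⇒-cong : Congruent₂ _⇒_
    ′-cong : Congruent₁ _′

  _* : Op₁ Carrier
  x * = x ⇒ 𝟘

  _≤_ : Rel Carrier ℓ
  x ≤ y = x ∧ y ≈ x

  -- x⁽ⁿ⁾
  iter : ℕ → Carrier → Carrier
  iter zero    x = x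
  iter (suc n) x = ((iter n x) ′) *

  -- tₙ(x)
  level : ℕ → Carrier → Carrier
  level zero    x = x
  level (suc n) x = level n x ∧ iter (suc n) x

module _ {c ℓ : Level} where

  record IsSemiHeyting (A : Algebra c ℓ) : Set (c ⊔ ℓ) where
    open Algebra A
    open AlgDefs _≈_ using (Identity)
    field
      isLattice  : IsLattice _≈_ _∨_ _∧_
      ∨-identity : Identity 𝟘 _∨_
      ∧-identity : Identity 𝟙 _∧_
      ∧-⇒        : ∀ x y → x ∧ (x ⇒ y) ≈ x ∧ y
      ∧-⇒-∧      : ∀ x y z → x ∧ (y ⇒ z) ≈ x ∧ ((x ∧ y) ⇒ (x ∧ z))
      ⇒-refl     : ∀ x → x ⇒ x ≈ 𝟙

  record DQD (A : Algebra c ℓ) : Set (c ⊔ ℓ) where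
    open Algebra A
    field
      isSemiHeyting : IsSemiHeyting A
      𝟘′            : 𝟘 ′ ≈ 𝟙
      𝟙′            : 𝟙 ′ ≈ 𝟘
      ∧-′           : ∀ x y → (x ∧ y) ′ ≈ x ′ ∨ y ′
      ∨-′′          : ∀ x y → ((x ∨ y) ′) ′ ≈ (x ′) ′ ∨ (y ′) ′
      ′′-≤          : ∀ x → (x ′) ′ ≤ x

  record JID (A : Algebra c ℓ) : Set (c ⊔ ℓ) where
    open Algebra A
    field
      isDQD : DQD A
      ji    : ∀ x y z → x ′ ∨ (y ⇒ z) ≈ (x ′ ∨ y) ⇒ (x ′ ∨ z)

  record DQDₙ (n : ℕ) (A : Algebra c ℓ) : Set (c ⊔ ℓ) where
    open Algebra A
    field
      isDQD   : DQD A
      level-n : ∀ x → level n x ≈ level (suc n) x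

data Term (X : Set) : Set where
  var             : X → Term X
  _∨ᵗ_ _∧ᵗ_ _⇒ᵗ_  : Term X → Term X → Term X
  _′ᵗ             : Term X → Term X
  𝟘ᵗ 𝟙ᵗ           : Term X

Equation : Set
Equation = Term ℕ × Term ℕ

module _ {c ℓ : Level} (A : Algebra c ℓ) where
  open Algebra A

  ⟦_⟧ : {X : Set} → Term X → (X → Carrier) → Carrier
  ⟦ var x  ⟧ ρ = ρ x
  ⟦ s ∨ᵗ t ⟧ ρ = ⟦ s ⟧ ρ ∨ ⟦ t ⟧ ρ
  ⟦ s ∧ᵗ t ⟧ ρ = ⟦ s ⟧ ρ ∧ ⟦ t ⟧ ρ
  ⟦ s ⇒ᵗ t ⟧ ρ = ⟦ s ⟧ ρ ⇒ ⟦ t ⟧ ρ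
  ⟦ t ′ᵗ   ⟧ ρ = (⟦ t ⟧ ρ) ′
  ⟦ 𝟘ᵗ     ⟧ ρ = 𝟘
  ⟦ 𝟙ᵗ     ⟧ ρ = 𝟙

  Satisfies : Equation → Set (c ⊔ ℓ)
  Satisfies (s , t) = (ρ : ℕ → Carrier) → ⟦ s ⟧ ρ ≈ ⟦ t ⟧ ρ

  RepresentsDiscriminator : Term (Fin 3) → Set (c ⊔ ℓ)
  RepresentsDiscriminator t =
      (∀ x z → ⟦t⟧ x x z ≈ z)
    × (∀ x y z → ¬ (x ≈ y) → ⟦t⟧ x y z ≈ x)
    where
    ⟦t⟧ : Carrier → Carrier → Carrier → Carrier
    ⟦t⟧ x y z = ⟦ t ⟧ (lookup (x ∷ y ∷ z ∷ []))

module _ {c ℓ : Level} where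

  Models : Pred Equation 0ℓ → Pred (Algebra c ℓ) (c ⊔ ℓ)
  Models E A = ∀ e → E e → Satisfies A e

  -- The least equational class containing K.  Restricting to sets E of
  -- equations in the lowest universe loses nothing: a class Models E is the
  -- intersection of the classes defined by the single equations in E.
  GeneratedVariety : ∀ {k} → Pred (Algebra c ℓ) k →
                     Pred (Algebra c ℓ) (lsuc (c ⊔ ℓ) ⊔ k)
  GeneratedVariety K A =
    (E : Pred Equation 0ℓ) → (∀ B → K B → Models E B) → Models E A

  IsDiscriminatorVariety : ∀ {v} → Pred (Algebra c ℓ) v →
                           Set (lsuc (c ⊔ ℓ) ⊔ v)
  IsDiscriminatorVariety V =
    Σ[ K ∈ Pred (Algebra c ℓ) (c ⊔ ℓ) ]
    Σ[ t ∈ Term (Fin 3) ]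
      (∀ A → K A → RepresentsDiscriminator A t)
    × (∀ A → V A ⇔ GeneratedVariety K A)

{-# OPTIONS --safe #-}
module Submission where

-- In a JID-algebra every element x′ has the complement x′*: this is the
-- instance y = x′, z = 0 of the join-implication identity.  The map x ↦ x′′
-- preserves joins and lies below the identity, hence fixes every
-- complemented element, and so ′ maps complementary pairs to complementary
-- pairs.  In particular x′*′ is a complement of x′′, so x′*′* = x′′ and
-- x⁽³⁾ = x⁽¹⁾, which gives level 2.
--
-- Call p central if p′ is its complement.  Agreement after meeting with a
-- central element is a congruence, and among the central elements on which
-- x and y agree there is a largest one,
--   E(x,y) = ∇((x ⇒ y) ∧ (y ⇒ x)),   where ∇w = w′′ ∧ w′*.
-- Thus a filter F yields the congruence E(x,y) ∈ F, and if F is maximal on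
-- central elements then (E(x,y) ∧ z) ∨ (E(x,y)′ ∧ x) represents the
-- discriminator on the quotient.
--
-- It remains to see that the JID-algebras on which this term represents the
-- discriminator generate JID.  One inclusion holds because JID is defined
-- by equations.  For the other, let A be in JID and let s ≈ t be an equation
-- true in all these discriminator algebras; the classical argument extends
-- the filter generated by E(s,t)′ to a maximal one.  To make this
-- constructive, the elements under consideration are restricted to the
-- values of terms, which can be enumerated, and falsity is replaced
-- throughout by the proposition G that s and t have equal values in A.
-- Filters are made stable under double negation relative to G, so extending
-- a filter requires no case distinction, and a maximal filter F is one such
-- that (p ∈ F → G) implies p′ ∈ F.  Since an absurd hypothesis implies G,
-- this is stronger than what the discriminator requires.  The equation holds
-- in the quotient by F, so E(s,t) ∈ F as well as E(s,t)′ ∈ F; hence 0 ∈ F,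
-- which by properness relative to G means that s and t are equal in A.

open import Defs
open import Level using (Level; _⊔_; 0ℓ; Lift; lift; lower) renaming (suc to lsuc)
open import Algebra.Definitions using (Congruent₂)
open import Algebra.Lattice.Bundles using () renaming (Lattice to AlgebraicLattice)
open import Algebra.Lattice.Structures using (IsLattice)
import Algebra.Lattice.Properties.Lattice as AlgebraicLatticeProperties
open import Data.Fin.Base using (Fin; zero; suc)
open import Data.List.Base using
  (List; []; _∷_; _++_; foldr; map; cartesianProductWith)
open import Data.List.Membership.Propositional using (_∈_)
open import Data.List.Membership.Propositional.Properties using
  (∈-++⁺ˡ; ∈-++⁺ʳ; ∈-map⁺; ∈-cartesianProductWith⁺)
open import Data.List.Relation.Unary.Any using (here; there)
open import Data.Nat.Base using (ℕ; zero; suc; _≤′_; ≤′-refl; ≤′-step) renaming (_⊔_ to max)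
open import Data.Nat.Properties using (m≤m⊔n; m≤n⊔m; ≤⇒≤′)
open import Data.Product.Base using (_×_; _,_; proj₁; proj₂; ∃; Σ-syntax)
open import Function.Bundles using (_⇔_; mk⇔)
open import Relation.Binary.Core using (Rel)
open import Relation.Binary.Lattice.Bundles using (Lattice; HeytingAlgebra)
import Relation.Binary.Lattice.Properties.HeytingAlgebra as HeytingProperties
import Relation.Binary.Lattice.Properties.DistributiveLattice as DistributiveProperties
import Relation.Binary.Lattice.Properties.MeetSemilattice as MeetProperties
import Relation.Binary.Lattice.Properties.JoinSemilattice as JoinProperties
import Relation.Binary.Lattice.Properties.BoundedLattice as BoundedProperties
import Relation.Binary.Reasoning.PartialOrder as PartialOrderReasoning
open import Relation.Binary.PropositionalEquality as ≡ using (_≡_)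
open import Relation.Binary.Structures using (IsEquivalence)
open import Relation.Nullary.Negation.Core using (contradiction)
open import Relation.Unary using (Pred; _⊆_)

-- Semi-Heyting algebras

module SemiHeytingProperties
  {c ℓ : Level} (A : Algebra c ℓ) (isSH : IsSemiHeyting A) where

  open Algebra A hiding (_≤_)
  open IsSemiHeyting isSH
  open IsEquivalence isEquivalence

  private
    algebraicLattice : AlgebraicLattice c ℓ
    algebraicLattice = record { isLattice = isLattice }

    module L = AlgebraicLatticeProperties algebraicLattice

    -- Its order is x ≈ x ∧ y, the symmetric form of the order of A.
    lattice : Lattice c ℓ ℓ
    lattice = L.∨-∧-orderTheoreticLattice

  open Lattice lattice public using (_≤_; x∧y≤x; x∧y≤y; ∧-greatest; poset)
    renaming (refl to ≤-refl; trans to ≤-trans; reflexive to ≤-reflexive)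
  open MeetProperties (Lattice.meetSemilattice lattice) public
    using (∧-monotonic; ∧-comm; ∧-assoc)
  open PartialOrderReasoning poset

  -- Elements on which x and y agree lie below x ⇒ y.
  agree⇒≤-⇒ : ∀ {z x y} → z ∧ x ≈ z ∧ y → z ≤ x ⇒ y
  agree⇒≤-⇒ {z} {x} {y} zx≈zy = sym (begin-equality
    z ∧ (x ⇒ y)              ≈⟨ ∧-⇒-∧ z x y ⟩
    z ∧ ((z ∧ x) ⇒ (z ∧ y))  ≈⟨ ∧-cong refl (⇒-cong refl (sym zx≈zy)) ⟩
    z ∧ ((z ∧ x) ⇒ (z ∧ x))  ≈⟨ ∧-cong refl (⇒-refl (z ∧ x)) ⟩
    z ∧ 𝟙                    ≈⟨ proj₂ ∧-identity z ⟩
    z                        ∎)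

  ⇒-eval : ∀ x y → (x ⇒ y) ∧ x ≤ y
  ⇒-eval x y = begin
    (x ⇒ y) ∧ x  ≈⟨ ∧-comm (x ⇒ y) x ⟩
    x ∧ (x ⇒ y)  ≈⟨ ∧-⇒ x y ⟩
    x ∧ y        ≤⟨ x∧y≤y x y ⟩
    y            ∎

  -- The operation x ⇒ (x ∧ y) is the residual of the meet, so the
  -- underlying lattice is a Heyting algebra and hence distributive.
  heytingAlgebra : HeytingAlgebra c ℓ ℓ
  heytingAlgebra = record
    { _≤_ = _≤_
    ; _∨_ = _∨_
    ; _∧_ = _∧_
    ; _⇨_ = λ x y → x ⇒ (x ∧ y)
    ; ⊤   = 𝟙
    ; ⊥   = 𝟘
    ; isHeytingAlgebra = record
      { isBoundedLattice = record
        { isLattice = L.∨-∧-isOrderTheoreticLattice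
        ; maximum   = λ x → sym (proj₂ ∧-identity x)
        ; minimum   = λ x → ≤-trans (Lattice.x≤x∨y lattice 𝟘 x)
                                    (≤-reflexive (proj₁ ∨-identity x))
        }
      ; exponential = λ w x y → residual , coresidual
      }
    }
    where
    residual : ∀ {w x y} → w ∧ x ≤ y → w ≤ x ⇒ (x ∧ y)
    residual {w} {x} {y} wx≤y = agree⇒≤-⇒ (trans wx≤y (∧-assoc w x y))

    coresidual : ∀ {w x y} → w ≤ x ⇒ (x ∧ y) → w ∧ x ≤ y
    coresidual {w} {x} {y} w≤ = begin
      w ∧ x              ≤⟨ ∧-monotonic w≤ ≤-refl ⟩
      (x ⇒ (x ∧ y)) ∧ x  ≤⟨ ⇒-eval x (x ∧ y) ⟩
      x ∧ y              ≤⟨ x∧y≤y x y ⟩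
      y                  ∎

  open HeytingAlgebra heytingAlgebra public
    using (antisym; x≤x∨y; y≤x∨y; ∨-least; maximum; minimum)
  open HeytingProperties heytingAlgebra public
    using (∧-distribˡ-∨; distributiveLattice)
  open DistributiveProperties distributiveLattice public using (∨-distribˡ-∧)
  open JoinProperties (HeytingAlgebra.joinSemilattice heytingAlgebra) public
    using (∨-comm; ∨-monotonic)
  open BoundedProperties (HeytingAlgebra.boundedLattice heytingAlgebra) public
    using (∧-zeroˡ; ∧-zeroʳ)

  -- To prove an inequality it suffices to do so on each part of a cover.
  ≤-by-cover : ∀ {p q z y} → p ∨ q ≈ 𝟙 → z ∧ p ≤ y → z ∧ q ≤ y → z ≤ y
  ≤-by-cover {p} {q} {z} {y} p∨q≈1 zp≤y zq≤y = begin
    z                  ≈⟨ proj₂ ∧-identity z ⟨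
    z ∧ 𝟙              ≈⟨ ∧-cong refl p∨q≈1 ⟨
    z ∧ (p ∨ q)        ≈⟨ ∧-distribˡ-∨ z p q ⟩
    z ∧ p ∨ z ∧ q      ≤⟨ ∨-least zp≤y zq≤y ⟩
    y                  ∎

  x∧x*≈0 : ∀ x → x ∧ x * ≈ 𝟘
  x∧x*≈0 x = trans (∧-⇒ x 𝟘) (∧-zeroʳ x)

  disjoint⇒≤* : ∀ {z x} → z ∧ x ≈ 𝟘 → z ≤ x *
  disjoint⇒≤* zx≈0 = agree⇒≤-⇒ (trans zx≈0 (sym (∧-zeroʳ _)))

  ≤0⇒≈0 : ∀ {x} → x ≤ 𝟘 → x ≈ 𝟘
  ≤0⇒≈0 x≤0 = antisym x≤0 (minimum _)

  -- Complements in the bounded lattice reduct.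
  Complement : Rel Carrier ℓ
  Complement p q = (p ∨ q ≈ 𝟙) × (p ∧ q ≈ 𝟘)

  complement-sym : ∀ {p q} → Complement p q → Complement q p
  complement-sym {p} {q} (join , meet) =
    trans (∨-comm q p) join , trans (∧-comm q p) meet

  complement-congʳ : ∀ {p q r} → q ≈ r → Complement p q → Complement p r
  complement-congʳ q≈r (join , meet) =
    trans (∨-cong refl (sym q≈r)) join , trans (∧-cong refl (sym q≈r)) meet

  complement⇒≈* : ∀ {p q} → Complement p q → p * ≈ q
  complement⇒≈* {p} {q} cpl@(join , meet) = antisym
    (≤-by-cover join
      (≤-trans (≤-reflexive (trans (∧-comm (p *) p) (x∧x*≈0 p))) (minimum q))
      (x∧y≤y (p *) q))
    (disjoint⇒≤* (proj₂ (complement-sym cpl)))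

  complement-∧ : ∀ {a b p q} → Complement a b → Complement p q →
                 Complement (a ∧ p) (b ∨ q)
  complement-∧ {a} {b} {p} {q} (a∨b≈1 , a∧b≈0) (p∨q≈1 , p∧q≈0) =
    antisym (maximum _)
      (≤-by-cover a∨b≈1
        (≤-by-cover p∨q≈1
          (≤-trans (∧-monotonic (x∧y≤y 𝟙 a) ≤-refl) (x≤x∨y (a ∧ p) (b ∨ q)))
          (≤-trans (x∧y≤y _ q) (≤-trans (y≤x∨y b q) (y≤x∨y (a ∧ p) (b ∨ q)))))
        (≤-trans (x∧y≤y 𝟙 b) (≤-trans (x≤x∨y b q) (y≤x∨y (a ∧ p) (b ∨ q))))) ,
    ≤0⇒≈0 (≤-trans (≤-reflexive (∧-distribˡ-∨ (a ∧ p) b q))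
      (∨-least
        (≤-trans (∧-monotonic (x∧y≤x a p) ≤-refl) (≤-reflexive a∧b≈0))
        (≤-trans (∧-monotonic (x∧y≤y a p) ≤-refl) (≤-reflexive p∧q≈0))))

  -- Meeting with e selects the second branch of the case distinction
  -- (d ∧ z) ∨ (e ∧ x).
  complement-select : ∀ {d e} → Complement d e → ∀ x z →
                      e ∧ (d ∧ z ∨ e ∧ x) ≈ e ∧ x
  complement-select {d} {e} (_ , d∧e≈0) x z = antisym
    (≤-trans (≤-reflexive (∧-distribˡ-∨ e (d ∧ z) (e ∧ x)))
      (∨-least
        (begin
          e ∧ (d ∧ z)  ≤⟨ ∧-greatest (≤-trans (x∧y≤y e _) (x∧y≤x d z)) (x∧y≤x e _) ⟩
          d ∧ e        ≈⟨ d∧e≈0 ⟩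
          𝟘            ≤⟨ minimum _ ⟩
          e ∧ x        ∎)
        (x∧y≤y e (e ∧ x))))
    (∧-greatest (x∧y≤x e x) (y≤x∨y (d ∧ z) (e ∧ x)))

-- The central elements of a JID-algebra

module JIDProperties
  {c ℓ : Level} (A : Algebra c ℓ) (isJID : JID A) where

  open Algebra A hiding (_≤_)
  open JID isJID
  open DQD isDQD
  open IsSemiHeyting isSemiHeyting using (∧-identity; ∨-identity; ∧-⇒-∧; ⇒-refl)
  open IsEquivalence isEquivalence
  open SemiHeytingProperties A isSemiHeyting public
  open PartialOrderReasoning poset

  𝟙′′≈𝟙 : (𝟙 ′) ′ ≈ 𝟙
  𝟙′′≈𝟙 = trans (′-cong 𝟙′) 𝟘′

  ′′-deflationary : ∀ x → (x ′) ′ ≤ x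
  ′′-deflationary x = sym (′′-≤ x)

  ′-antitone : ∀ {x y} → x ≤ y → y ′ ≤ x ′
  ′-antitone {x} {y} x≤y = begin
    y ′          ≤⟨ y≤x∨y (x ′) (y ′) ⟩
    x ′ ∨ y ′    ≈⟨ ∧-′ x y ⟨
    (x ∧ y) ′    ≈⟨ ′-cong x≤y ⟨
    x ′          ∎

  ′′′≈′ : ∀ x → ((x ′) ′) ′ ≈ x ′
  ′′′≈′ x = antisym (′′-deflationary (x ′)) (′-antitone (′′-deflationary x))

  -- The join-implication identity with y = x′ and z = 0 reads x′ ∨ x′* = 1.
  ′-complement-* : ∀ x → Complement (x ′) (x ′ *)
  ′-complement-* x =
    (begin-equality
      x ′ ∨ (x ′ ⇒ 𝟘)            ≈⟨ ji x (x ′) 𝟘 ⟩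
      (x ′ ∨ x ′) ⇒ (x ′ ∨ 𝟘)    ≈⟨ ⇒-cong (antisym (∨-least ≤-refl ≤-refl) (x≤x∨y _ _))
                                           (proj₂ ∨-identity (x ′)) ⟩
      x ′ ⇒ x ′                  ≈⟨ ⇒-refl (x ′) ⟩
      𝟙                          ∎) ,
    x∧x*≈0 (x ′)

  -- The interior map ′′ preserves the cover p ∨ q = 1, so p is covered by
  -- p′′ and by p ∧ q′′, which vanishes.
  complemented⇒′′-fixed : ∀ {p q} → Complement p q → (p ′) ′ ≈ p
  complemented⇒′′-fixed {p} {q} (join , meet) = antisym (′′-deflationary p)
    (≤-by-cover p′′∨q′′≈𝟙 (x∧y≤y p ((p ′) ′))
      (begin
        p ∧ (q ′) ′  ≤⟨ ∧-monotonic ≤-refl (′′-deflationary q) ⟩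
        p ∧ q        ≈⟨ meet ⟩
        𝟘            ≤⟨ minimum _ ⟩
        (p ′) ′      ∎))
    where
    p′′∨q′′≈𝟙 : (p ′) ′ ∨ (q ′) ′ ≈ 𝟙
    p′′∨q′′≈𝟙 = trans (sym (∨-′′ p q)) (trans (′-cong (′-cong join)) 𝟙′′≈𝟙)

  complement-′ : ∀ {p q} → Complement p q → Complement (p ′) (q ′)
  complement-′ {p} {q} (join , meet) =
    trans (sym (∧-′ p q)) (trans (′-cong meet) 𝟘′) ,
    (begin-equality
      p ′ ∧ q ′                    ≈⟨ complemented⇒′′-fixed
                                        (complement-∧ (′-complement-* p) (′-complement-* q)) ⟨
      ((p ′ ∧ q ′) ′) ′            ≈⟨ ′-cong (∧-′ (p ′) (q ′)) ⟩
      ((p ′) ′ ∨ (q ′) ′) ′        ≈⟨ ′-cong (∨-′′ p q) ⟨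
      (((p ∨ q) ′) ′) ′            ≈⟨ ′′′≈′ (p ∨ q) ⟩
      (p ∨ q) ′                    ≈⟨ ′-cong join ⟩
      𝟙 ′                          ≈⟨ 𝟙′ ⟩
      𝟘                            ∎)

  -- Applied to x′ and x′*, the previous lemma makes x′′ and x′*′
  -- complements.
  ′*′*≈′′ : ∀ x → ((x ′ *) ′) * ≈ (x ′) ′
  ′*′*≈′′ x = complement⇒≈* (complement-sym (complement-′ (′-complement-* x)))

  level-2 : ∀ x → level 2 x ≈ level 3 x
  level-2 x = begin-equality
    level 2 x               ≈⟨ ≤-trans (x∧y≤x _ _) (x∧y≤y _ _) ⟩
    level 2 x ∧ iter 1 x    ≈⟨ ∧-cong refl iter-3 ⟨
    level 2 x ∧ iter 3 x    ∎
    where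
    iter-3 : iter 3 x ≈ iter 1 x
    iter-3 = ⇒-cong (trans (′-cong (′*′*≈′′ x)) (′′′≈′ x)) refl

  -- The elements p with complement p′.
  Central : Pred Carrier ℓ
  Central p = Complement p (p ′)

  𝟙-central : Central 𝟙
  𝟙-central = antisym (maximum _) (x≤x∨y 𝟙 (𝟙 ′)) , trans (proj₁ ∧-identity (𝟙 ′)) 𝟙′

  ∧-central : ∀ {p q} → Central p → Central q → Central (p ∧ q)
  ∧-central {p} {q} Zp Zq =
    complement-congʳ (sym (∧-′ p q)) (complement-∧ Zp Zq)

  ′-central : ∀ {p} → Central p → Central (p ′)
  ′-central = complement-′

  -- The largest central element below w.
  ∇ : Carrier → Carrier
  ∇ w = (w ′) ′ ∧ w ′ *

  ∇-central : ∀ w → Central (∇ w)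
  ∇-central w = complement-congʳ
    (begin-equality
      ((w ′) *) ′ ∨ w ′              ≈⟨ ∨-comm _ _ ⟩
      w ′ ∨ ((w ′) *) ′              ≈⟨ ∨-cong (′′′≈′ w) refl ⟨
      ((w ′) ′) ′ ∨ ((w ′) *) ′      ≈⟨ ∧-′ _ _ ⟨
      (∇ w) ′                        ∎)
    (complement-∧ (complement-′ w′-cpl) (complement-sym w′-cpl))
    where w′-cpl = ′-complement-* w

  ∇-deflationary : ∀ w → ∇ w ≤ w
  ∇-deflationary w = ≤-trans (x∧y≤x _ _) (′′-deflationary w)

  ∇-greatest : ∀ {p w} → Central p → p ≤ w → p ≤ ∇ w
  ∇-greatest {p} {w} Zp@(_ , p∧p′≈0) p≤w = ∧-greatest
    (begin
      p            ≈⟨ complemented⇒′′-fixed Zp ⟨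
      (p ′) ′      ≤⟨ ′-antitone (′-antitone p≤w) ⟩
      (w ′) ′      ∎)
    (disjoint⇒≤* (≤0⇒≈0
      (≤-trans (∧-monotonic ≤-refl (′-antitone p≤w)) (≤-reflexive p∧p′≈0))))

  -- The largest central element on which x and y agree: the Boolean truth
  -- value of the equation x = y.
  E : Carrier → Carrier → Carrier
  E x y = ∇ ((x ⇒ y) ∧ (y ⇒ x))

  E-central : ∀ x y → Central (E x y)
  E-central x y = ∇-central _

  E-≤ : ∀ x y → E x y ∧ x ≤ y
  E-≤ x y = ≤-trans
    (∧-monotonic (≤-trans (∇-deflationary _) (x∧y≤x (x ⇒ y) (y ⇒ x))) ≤-refl)
    (⇒-eval x y)

  E-greatest : ∀ {p x y} → Central p → p ∧ x ≈ p ∧ y → p ≤ E x y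
  E-greatest Zp px≈py =
    ∇-greatest Zp (∧-greatest (agree⇒≤-⇒ px≈py) (agree⇒≤-⇒ (sym px≈py)))

  E-sym : ∀ x y → E x y ≤ E y x
  E-sym x y = ≤-reflexive (∧-cong (′-cong (′-cong swapped)) (⇒-cong (′-cong swapped) refl))
    where swapped = ∧-comm (x ⇒ y) (y ⇒ x)

  E-agree : ∀ x y → E x y ∧ x ≈ E x y ∧ y
  E-agree x y = antisym
    (∧-greatest (x∧y≤x _ x) (E-≤ x y))
    (∧-greatest (x∧y≤x _ y) (≤-trans (∧-monotonic (E-sym x y) ≤-refl) (E-≤ y x)))

  ≤-E-agree : ∀ {p x y} → p ≤ E x y → p ∧ x ≈ p ∧ y
  ≤-E-agree {p} {x} {y} p≤E = begin-equality
    p ∧ x              ≈⟨ ∧-cong p≤E refl ⟩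
    (p ∧ E x y) ∧ x    ≈⟨ ∧-assoc p _ x ⟩
    p ∧ (E x y ∧ x)    ≈⟨ ∧-cong refl (E-agree x y) ⟩
    p ∧ (E x y ∧ y)    ≈⟨ ∧-assoc p _ y ⟨
    (p ∧ E x y) ∧ y    ≈⟨ ∧-cong p≤E refl ⟨
    p ∧ y              ∎

  E-≈𝟙 : ∀ {x y} → x ≈ y → E x y ≈ 𝟙
  E-≈𝟙 x≈y = antisym (maximum _) (E-greatest 𝟙-central (∧-cong refl x≈y))

  𝟙≤E⇒≈ : ∀ {x y} → 𝟙 ≤ E x y → x ≈ y
  𝟙≤E⇒≈ {x} {y} 𝟙≤E =
    trans (sym (proj₁ ∧-identity x)) (trans (≤-E-agree 𝟙≤E) (proj₁ ∧-identity y))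

  E-trans : ∀ x y z → E x y ∧ E y z ≤ E x z
  E-trans x y z = E-greatest (∧-central (E-central x y) (E-central y z))
    (trans (≤-E-agree (x∧y≤x _ _)) (≤-E-agree (x∧y≤y _ _)))

  -- An operation is compatible with E as soon as it is local: for central p,
  -- its value, met with p, depends only on the arguments met with p.
  E-cong₂ : {f : Carrier → Carrier → Carrier} → Congruent₂ _≈_ f →
            (∀ {p} → Central p → ∀ x u → p ∧ f x u ≈ p ∧ f (p ∧ x) (p ∧ u)) →
            ∀ x y u v → E x y ∧ E u v ≤ E (f x u) (f y v)
  E-cong₂ {f} f-cong local x y u v = E-greatest Zp
    (begin-equality
      p ∧ f x u              ≈⟨ local Zp x u ⟩
      p ∧ f (p ∧ x) (p ∧ u)  ≈⟨ ∧-cong refl (f-cong (≤-E-agree (x∧y≤x _ _))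
                                                    (≤-E-agree (x∧y≤y _ _))) ⟩
      p ∧ f (p ∧ y) (p ∧ v)  ≈⟨ local Zp y v ⟨
      p ∧ f y v              ∎)
    where
    p  = E x y ∧ E u v
    Zp = ∧-central (E-central x y) (E-central u v)

  ∧-local : ∀ p x u → p ∧ (x ∧ u) ≈ p ∧ ((p ∧ x) ∧ (p ∧ u))
  ∧-local p x u = antisym
    (∧-greatest (x∧y≤x p _) (∧-greatest
      (∧-monotonic ≤-refl (x∧y≤x x u)) (∧-monotonic ≤-refl (x∧y≤y x u))))
    (∧-monotonic ≤-refl (∧-monotonic (x∧y≤y p x) (x∧y≤y p u)))

  ∨-local : ∀ p x u → p ∧ (x ∨ u) ≈ p ∧ ((p ∧ x) ∨ (p ∧ u))
  ∨-local p x u = antisym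
    (∧-greatest (x∧y≤x p _) (≤-reflexive (∧-distribˡ-∨ p x u)))
    (∧-monotonic ≤-refl (∨-monotonic (x∧y≤y p x) (x∧y≤y p u)))

  ′-local : ∀ {p} → Central p → ∀ x → p ∧ x ′ ≈ p ∧ (p ∧ x) ′
  ′-local {p} (_ , p∧p′≈0) x = antisym
    (∧-monotonic ≤-refl (′-antitone (x∧y≤y p x)))
    (begin
      p ∧ (p ∧ x) ′            ≈⟨ ∧-cong refl (∧-′ p x) ⟩
      p ∧ (p ′ ∨ x ′)          ≈⟨ ∧-distribˡ-∨ p (p ′) (x ′) ⟩
      p ∧ p ′ ∨ p ∧ x ′        ≈⟨ ∨-cong p∧p′≈0 refl ⟩
      𝟘 ∨ p ∧ x ′              ≈⟨ proj₁ ∨-identity _ ⟩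
      p ∧ x ′                  ∎)

  E-∧ : ∀ x y u v → E x y ∧ E u v ≤ E (x ∧ u) (y ∧ v)
  E-∧ = E-cong₂ ∧-cong (λ {p} _ → ∧-local p)

  E-∨ : ∀ x y u v → E x y ∧ E u v ≤ E (x ∨ u) (y ∨ v)
  E-∨ = E-cong₂ ∨-cong (λ {p} _ → ∨-local p)

  E-⇒ : ∀ x y u v → E x y ∧ E u v ≤ E (x ⇒ u) (y ⇒ v)
  E-⇒ = E-cong₂ ⇒-cong (λ {p} _ → ∧-⇒-∧ p)

  E-′ : ∀ x y → E x y ≤ E (x ′) (y ′)
  E-′ x y = E-greatest Zp
    (begin-equality
      p ∧ x ′          ≈⟨ ′-local Zp x ⟩
      p ∧ (p ∧ x) ′    ≈⟨ ∧-cong refl (′-cong (E-agree x y)) ⟩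
      p ∧ (p ∧ y) ′    ≈⟨ ′-local Zp y ⟨
      p ∧ y ′          ∎)
    where
    p  = E x y
    Zp = E-central x y

-- Equational axioms for JID

private
  x₀ x₁ x₂ : Term ℕ
  x₀ = var 0
  x₁ = var 1
  x₂ = var 2

-- The identities defining JID, with lattice axioms for the lattice reduct.
data JIDAxiom : Pred Equation 0ℓ where
  ∨-comm      : JIDAxiom ((x₀ ∨ᵗ x₁) , (x₁ ∨ᵗ x₀))
  ∨-assoc     : JIDAxiom (((x₀ ∨ᵗ x₁) ∨ᵗ x₂) , (x₀ ∨ᵗ (x₁ ∨ᵗ x₂)))
  ∧-comm      : JIDAxiom ((x₀ ∧ᵗ x₁) , (x₁ ∧ᵗ x₀))
  ∧-assoc     : JIDAxiom (((x₀ ∧ᵗ x₁) ∧ᵗ x₂) , (x₀ ∧ᵗ (x₁ ∧ᵗ x₂)))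
  ∨-absorbs-∧ : JIDAxiom ((x₀ ∨ᵗ (x₀ ∧ᵗ x₁)) , x₀)
  ∧-absorbs-∨ : JIDAxiom ((x₀ ∧ᵗ (x₀ ∨ᵗ x₁)) , x₀)
  ∨-identityˡ : JIDAxiom ((𝟘ᵗ ∨ᵗ x₀) , x₀)
  ∨-identityʳ : JIDAxiom ((x₀ ∨ᵗ 𝟘ᵗ) , x₀)
  ∧-identityˡ : JIDAxiom ((𝟙ᵗ ∧ᵗ x₀) , x₀)
  ∧-identityʳ : JIDAxiom ((x₀ ∧ᵗ 𝟙ᵗ) , x₀)
  ∧-⇒         : JIDAxiom ((x₀ ∧ᵗ (x₀ ⇒ᵗ x₁)) , (x₀ ∧ᵗ x₁))
  ∧-⇒-∧       : JIDAxiom ((x₀ ∧ᵗ (x₁ ⇒ᵗ x₂)) ,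
                          (x₀ ∧ᵗ ((x₀ ∧ᵗ x₁) ⇒ᵗ (x₀ ∧ᵗ x₂))))
  ⇒-refl      : JIDAxiom ((x₀ ⇒ᵗ x₀) , 𝟙ᵗ)
  𝟘′          : JIDAxiom ((𝟘ᵗ ′ᵗ) , 𝟙ᵗ)
  𝟙′          : JIDAxiom ((𝟙ᵗ ′ᵗ) , 𝟘ᵗ)
  ∧-′         : JIDAxiom (((x₀ ∧ᵗ x₁) ′ᵗ) , ((x₀ ′ᵗ) ∨ᵗ (x₁ ′ᵗ)))
  ∨-′′        : JIDAxiom ((((x₀ ∨ᵗ x₁) ′ᵗ) ′ᵗ) , (((x₀ ′ᵗ) ′ᵗ) ∨ᵗ ((x₁ ′ᵗ) ′ᵗ)))
  ′′-≤        : JIDAxiom ((((x₀ ′ᵗ) ′ᵗ) ∧ᵗ x₀) , ((x₀ ′ᵗ) ′ᵗ))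
  ji          : JIDAxiom (((x₀ ′ᵗ) ∨ᵗ (x₁ ⇒ᵗ x₂)) ,
                          (((x₀ ′ᵗ) ∨ᵗ x₁) ⇒ᵗ ((x₀ ′ᵗ) ∨ᵗ x₂)))

module _ {c ℓ : Level} (A : Algebra c ℓ) where
  open Algebra A using (Carrier; isEquivalence; ∨-cong; ∧-cong)

  JID⇒models : JID A → Models JIDAxiom A
  JID⇒models isJID e ax ρ = holds ax
    where
    open JID isJID renaming (ji to ji-law)
    module D = DQD isDQD
    module S = IsSemiHeyting D.isSemiHeyting
    module L = IsLattice S.isLattice

    x = ρ 0
    y = ρ 1
    z = ρ 2

    holds : ∀ {e} → JIDAxiom e → Algebra._≈_ A (⟦ A ⟧ (proj₁ e) ρ) (⟦ A ⟧ (proj₂ e) ρ)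
    holds ∨-comm      = L.∨-comm x y
    holds ∨-assoc     = L.∨-assoc x y z
    holds ∧-comm      = L.∧-comm x y
    holds ∧-assoc     = L.∧-assoc x y z
    holds ∨-absorbs-∧ = proj₁ L.absorptive x y
    holds ∧-absorbs-∨ = proj₂ L.absorptive x y
    holds ∨-identityˡ = proj₁ S.∨-identity x
    holds ∨-identityʳ = proj₂ S.∨-identity x
    holds ∧-identityˡ = proj₁ S.∧-identity x
    holds ∧-identityʳ = proj₂ S.∧-identity x
    holds ∧-⇒         = S.∧-⇒ x y
    holds ∧-⇒-∧       = S.∧-⇒-∧ x y z
    holds ⇒-refl      = S.⇒-refl x
    holds 𝟘′          = D.𝟘′
    holds 𝟙′          = D.𝟙′
    holds ∧-′         = D.∧-′ x y
    holds ∨-′′        = D.∨-′′ x y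
    holds ′′-≤        = D.′′-≤ x
    holds ji          = ji-law x y z

  models⇒JID : Models JIDAxiom A → JID A
  models⇒JID ⊨ = record
    { isDQD = record
      { isSemiHeyting = record
        { isLattice = record
          { isEquivalence = isEquivalence
          ; ∨-comm        = λ x y → ⊨ _ ∨-comm (val x y x)
          ; ∨-assoc       = λ x y z → ⊨ _ ∨-assoc (val x y z)
          ; ∨-cong        = ∨-cong
          ; ∧-comm        = λ x y → ⊨ _ ∧-comm (val x y x)
          ; ∧-assoc       = λ x y z → ⊨ _ ∧-assoc (val x y z)
          ; ∧-cong        = ∧-cong
          ; absorptive    = (λ x y → ⊨ _ ∨-absorbs-∧ (val x y x)) ,
                            (λ x y → ⊨ _ ∧-absorbs-∨ (val x y x))
          }
        ; ∨-identity = (λ x → ⊨ _ ∨-identityˡ (val x x x)) ,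
                       (λ x → ⊨ _ ∨-identityʳ (val x x x))
        ; ∧-identity = (λ x → ⊨ _ ∧-identityˡ (val x x x)) ,
                       (λ x → ⊨ _ ∧-identityʳ (val x x x))
        ; ∧-⇒        = λ x y → ⊨ _ ∧-⇒ (val x y x)
        ; ∧-⇒-∧      = λ x y z → ⊨ _ ∧-⇒-∧ (val x y z)
        ; ⇒-refl     = λ x → ⊨ _ ⇒-refl (val x x x)
        }
      ; 𝟘′   = ⊨ _ 𝟘′ (λ _ → Algebra.𝟘 A)
      ; 𝟙′   = ⊨ _ 𝟙′ (λ _ → Algebra.𝟘 A)
      ; ∧-′  = λ x y → ⊨ _ ∧-′ (val x y x)
      ; ∨-′′ = λ x y → ⊨ _ ∨-′′ (val x y x)
      ; ′′-≤ = λ x → ⊨ _ ′′-≤ (val x x x)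
      }
    ; ji = λ x y z → ⊨ _ ji (val x y z)
    }
    where
    val : Carrier → Carrier → Carrier → ℕ → Carrier
    val x y z 0 = x
    val x y z 1 = y
    val x y z _ = z

-- An enumeration of terms

-- A cumulative sequence of finite lists that exhausts the terms.
terms : ℕ → List (Term ℕ)
terms zero    = []
terms (suc n) = terms n ++ 𝟘ᵗ ∷ 𝟙ᵗ ∷ var n ∷
  map _′ᵗ (terms n) ++ pairs _∨ᵗ_ ++ pairs _∧ᵗ_ ++ pairs _⇒ᵗ_
  where
  pairs : (Term ℕ → Term ℕ → Term ℕ) → List (Term ℕ)
  pairs f = cartesianProductWith f (terms n) (terms n)

terms-mono : ∀ {m n t} → m ≤′ n → t ∈ terms m → t ∈ terms n
terms-mono ≤′-refl     t∈ = t∈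
terms-mono (≤′-step p) t∈ = ∈-++⁺ˡ (terms-mono p t∈)

terms-exhaustive : ∀ t → ∃ λ n → t ∈ terms n
terms-exhaustive = exhaust
  where
  new : ∀ n {t xs} → t ∈ xs → t ∈ terms n ++ xs
  new n = ∈-++⁺ʳ (terms n)

  ops : ∀ n {t xs} → t ∈ xs → t ∈ terms n ++ 𝟘ᵗ ∷ 𝟙ᵗ ∷ var n ∷ xs
  ops n t∈ = new n (there (there (there t∈)))

  binary : ∀ {s t u} → (∃ λ n → s ∈ terms n) → (∃ λ n → t ∈ terms n) →
           (∀ n → s ∈ terms n → t ∈ terms n → u ∈ terms (suc n)) →
           ∃ λ n → u ∈ terms n
  binary (m , s∈) (n , t∈) build = suc (max m n) , build (max m n)
    (terms-mono (≤⇒≤′ (m≤m⊔n m n)) s∈) (terms-mono (≤⇒≤′ (m≤n⊔m m n)) t∈)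

  exhaust : ∀ t → ∃ λ n → t ∈ terms n
  exhaust (var n)  = suc n , new n (there (there (here ≡.refl)))
  exhaust (s ∨ᵗ t) = binary (exhaust s) (exhaust t) λ n s∈ t∈ →
    ops n (∈-++⁺ʳ (map _′ᵗ (terms n))
      (∈-++⁺ˡ (∈-cartesianProductWith⁺ _∨ᵗ_ s∈ t∈)))
  exhaust (s ∧ᵗ t) = binary (exhaust s) (exhaust t) λ n s∈ t∈ →
    ops n (∈-++⁺ʳ (map _′ᵗ (terms n))
      (∈-++⁺ʳ (cartesianProductWith _∨ᵗ_ (terms n) (terms n))
      (∈-++⁺ˡ (∈-cartesianProductWith⁺ _∧ᵗ_ s∈ t∈))))
  exhaust (s ⇒ᵗ t) = binary (exhaust s) (exhaust t) λ n s∈ t∈ →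
    ops n (∈-++⁺ʳ (map _′ᵗ (terms n))
      (∈-++⁺ʳ (cartesianProductWith _∨ᵗ_ (terms n) (terms n))
      (∈-++⁺ʳ (cartesianProductWith _∧ᵗ_ (terms n) (terms n))
      (∈-cartesianProductWith⁺ _⇒ᵗ_ s∈ t∈))))
  exhaust (t ′ᵗ)   = let n , t∈ = exhaust t in
    suc n , ops n (∈-++⁺ˡ (∈-map⁺ _′ᵗ t∈))
  exhaust 𝟘ᵗ       = 1 , here ≡.refl
  exhaust 𝟙ᵗ       = 1 , there (here ≡.refl)

-- Ultrafilters relative to a proposition

module RelativeFilters
  {c ℓ : Level} (A : Algebra c ℓ) (isJID : JID A) (G : Set ℓ) where

  open Algebra A hiding (_≤_)
  open IsEquivalence isEquivalence
  open JIDProperties A isJID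

  -- A lattice filter in which the proposition G plays the part of falsity:
  -- membership is stable under double negation relative to G, and
  -- properness means that membership of 0 yields G.
  record Filter : Set (c ⊔ lsuc ℓ) where
    field
      Mem    : Pred Carrier ℓ
      up     : ∀ {x y} → x ≤ y → Mem x → Mem y
      𝟙∈     : Mem 𝟙
      ∧∈     : ∀ {x y} → Mem x → Mem y → Mem (x ∧ y)
      stable : ∀ {x} → ((Mem x → G) → G) → Mem x
      proper : Mem 𝟘 → G

    explosion : ∀ {x} → G → Mem x
    explosion g = stable (λ _ → g)

  open Filter

  _⊑_ : Rel Filter (c ⊔ ℓ)
  F ⊑ F′ = ∀ {x} → Mem F x → Mem F′ x

  -- Maximality of a filter at a single element p, with G for falsity.
  Decides : Filter → Pred Carrier ℓ
  Decides F p = (Mem F p → G) → Mem F (p ′)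

  Decides-mono : ∀ {F F′ p} → F ⊑ F′ → Decides F p → Decides F′ p
  Decides-mono F⊑F′ decides p∉ = F⊑F′ (decides (λ p∈ → p∉ (F⊑F′ p∈)))

  principal : ∀ p → (p ≤ 𝟘 → G) → Filter
  principal p p≰0 = record
    { Mem    = λ x → (p ≤ x → G) → G
    ; up     = λ x≤y x∈ k → x∈ (λ p≤x → k (≤-trans p≤x x≤y))
    ; 𝟙∈     = λ k → k (maximum p)
    ; ∧∈     = λ x∈ y∈ k → x∈ (λ p≤x → y∈ (λ p≤y → k (∧-greatest p≤x p≤y)))
    ; stable = λ x∈ k → x∈ (λ p≤x → p≤x k)
    ; proper = λ 0∈ → 0∈ p≰0
    }

  -- For central p: the filter F if it contains p, and otherwise the filter
  -- generated by F and p′.  The two conjuncts express this case distinction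
  -- without deciding whether p belongs to F.
  extend : Filter → ∀ p → Filter
  extend F p = record
    { Mem    = λ x → ((Mem F p → G) → Mem F (p ∨ x)) × (Mem F p → Mem F x)
    ; up     = λ { x≤y (f , g) →
                   (λ p∉ → up F (∨-monotonic ≤-refl x≤y) (f p∉)) ,
                   (λ p∈ → up F x≤y (g p∈)) }
    ; 𝟙∈     = (λ _ → up F (y≤x∨y p 𝟙) (𝟙∈ F)) , (λ _ → 𝟙∈ F)
    ; ∧∈     = λ { {x} {y} (f , g) (f′ , g′) →
                   (λ p∉ → up F (≤-reflexive (sym (∨-distribˡ-∧ p x y)))
                                (∧∈ F (f p∉) (f′ p∉))) ,
                   (λ p∈ → ∧∈ F (g p∈) (g′ p∈)) }
    ; stable = λ xx →
        (λ p∉ → stable F (λ k → xx (λ { (f , _) → k (f p∉) }))) ,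
        (λ p∈ → stable F (λ k → xx (λ { (_ , g) → k (g p∈) })))
    ; proper = λ { (f , g) →
        let p∈ = stable F (λ p∉ → p∉ (up F (∨-least ≤-refl (minimum p)) (f p∉)))
        in proper F (g p∈) }
    }

  ⊑-extend : ∀ F p → F ⊑ extend F p
  ⊑-extend F p {x} x∈ = (λ _ → up F (y≤x∨y p x) x∈) , (λ _ → x∈)

  extend-decides : ∀ F {p} → Central p → Decides (extend F p) p
  extend-decides F {p} (p∨p′≈1 , _) p∉Q =
    (λ _ → up F (≤-reflexive (sym p∨p′≈1)) (𝟙∈ F)) ,
    (λ p∈ → explosion F (p∉Q (⊑-extend F p p∈)))

  -- The union of an ascending sequence of filters, closed off under double
  -- negation relative to G.
  module Union (F : ℕ → Filter) (ascending : ∀ n → F n ⊑ F (suc n)) where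

    F-mono : ∀ {m n} → m ≤′ n → F m ⊑ F n
    F-mono ≤′-refl       x∈ = x∈
    F-mono (≤′-step m≤n) x∈ = ascending _ (F-mono m≤n x∈)

    union : Filter
    union = record
      { Mem    = λ x → ((Σ[ n ∈ ℕ ] Mem (F n) x) → G) → G
      ; up     = λ x≤y x∈ k → x∈ (λ { (n , x∈n) → k (n , up (F n) x≤y x∈n) })
      ; 𝟙∈     = λ k → k (0 , 𝟙∈ (F 0))
      ; ∧∈     = λ x∈ y∈ k → x∈ (λ { (m , x∈m) → y∈ (λ { (n , y∈n) →
          k (max m n , ∧∈ (F (max m n))
              (F-mono (≤⇒≤′ (m≤m⊔n m n)) x∈m)
              (F-mono (≤⇒≤′ (m≤n⊔m m n)) y∈n)) }) })
      ; stable = λ x∈ k → x∈ (λ x∈′ → x∈′ k)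
      ; proper = λ 0∈ → 0∈ (λ { (n , 0∈n) → proper (F n) 0∈n })
      }

    ⊑-union : ∀ n → F n ⊑ union
    ⊑-union n x∈ k = k (n , x∈)

  -- The enumeration of all terms drives the extension to a maximal filter.
  module Lindenbaum (ρ : ℕ → Carrier) where

    value : Term ℕ → Carrier
    value t = ⟦ A ⟧ t ρ

    extendBy : Term ℕ → Filter → Filter
    extendBy t F = extend F (∇ (value t))

    ⊑-foldr : ∀ F ts → F ⊑ foldr extendBy F ts
    ⊑-foldr F []       x∈ = x∈
    ⊑-foldr F (t ∷ ts) x∈ =
      ⊑-extend (foldr extendBy F ts) (∇ (value t)) (⊑-foldr F ts x∈)

    foldr-decides : ∀ F {t ts} → t ∈ ts →
                    Decides (foldr extendBy F ts) (∇ (value t))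
    foldr-decides F {t} {_ ∷ ts} (here ≡.refl) =
      extend-decides (foldr extendBy F ts) (∇-central (value t))
    foldr-decides F {t} {u ∷ ts} (there t∈ts) =
      Decides-mono {foldr extendBy F ts} {foldr extendBy F (u ∷ ts)}
        (⊑-extend (foldr extendBy F ts) (∇ (value u))) (foldr-decides F t∈ts)

    -- Every filter extends to one that decides all ∇-values of terms.
    lindenbaum : ∀ F₀ → Σ[ F ∈ Filter ]
                   (F₀ ⊑ F) × (∀ t → Decides F (∇ (value t)))
    lindenbaum F₀ = union , ⊑-union 0 , λ t →
      let n , t∈ = terms-exhaustive t in
      Decides-mono {chain (suc n)} {union} (⊑-union (suc n))
        (foldr-decides (chain n) t∈)
      where
      chain : ℕ → Filter
      chain zero    = F₀
      chain (suc n) = foldr extendBy (chain n) (terms n)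

      open Union chain (λ n → ⊑-foldr (chain n) (terms n))

-- The discriminator term

module _ {X : Set} where

  ∇ᵗ : Term X → Term X
  ∇ᵗ w = ((w ′ᵗ) ′ᵗ) ∧ᵗ ((w ′ᵗ) ⇒ᵗ 𝟘ᵗ)

  biimplication : Term X → Term X → Term X
  biimplication s t = (s ⇒ᵗ t) ∧ᵗ (t ⇒ᵗ s)

  Eᵗ : Term X → Term X → Term X
  Eᵗ s t = ∇ᵗ (biimplication s t)

-- The term (E(x,y) ∧ z) ∨ (E(x,y)′ ∧ x).
discriminator : Term (Fin 3)
discriminator = (Eᵗ x y ∧ᵗ z) ∨ᵗ ((Eᵗ x y ′ᵗ) ∧ᵗ x)
  where
  x y z : Term (Fin 3)
  x = var zero
  y = var (suc zero)
  z = var (suc (suc zero))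

-- The JID-algebras on which the term above represents the discriminator.
DiscriminatorJID : ∀ {c ℓ} → Pred (Algebra c ℓ) (c ⊔ ℓ)
DiscriminatorJID A = JID A × RepresentsDiscriminator A discriminator

-- Quotients by relative ultrafilters

module Quotient
  {c ℓ : Level} (A : Algebra c ℓ) (isJID : JID A) (G : Set ℓ)
  (ρ : ℕ → Algebra.Carrier A) where

  open Algebra A hiding (_≤_)
  open IsSemiHeyting (DQD.isSemiHeyting (JID.isDQD isJID)) using (∨-identity; ∧-identity)
  open IsEquivalence isEquivalence
  open JIDProperties A isJID
  open RelativeFilters A isJID G
  open Lindenbaum ρ using (value)

  module _ (F : Filter) where

    open Filter F

    -- The subalgebra of A generated by the values of ρ, modulo the
    -- congruence E(x,y) ∈ F.  Its elements are presented by terms, since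
    -- these can be enumerated.
    quotient : Algebra c ℓ
    quotient = record
      { Carrier       = Lift c (Term ℕ)
      ; _≈_           = λ s t → Mem (E ⟪ s ⟫ ⟪ t ⟫)
      ; _∨_           = λ s t → lift (lower s ∨ᵗ lower t)
      ; _∧_           = λ s t → lift (lower s ∧ᵗ lower t)
      ; _⇒_           = λ s t → lift (lower s ⇒ᵗ lower t)
      ; _′            = λ s → lift (lower s ′ᵗ)
      ; 𝟘             = lift 𝟘ᵗ
      ; 𝟙             = lift 𝟙ᵗ
      ; isEquivalence = record
        { refl  = up (≤-reflexive (sym (E-≈𝟙 refl))) 𝟙∈
        ; sym   = up (E-sym _ _)
        ; trans = λ p q → up (E-trans _ _ _) (∧∈ p q)
        }
      ; ∨-cong        = λ p q → up (E-∨ _ _ _ _) (∧∈ p q)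
      ; ∧-cong        = λ p q → up (E-∧ _ _ _ _) (∧∈ p q)
      ; ⇒-cong        = λ p q → up (E-⇒ _ _ _ _) (∧∈ p q)
      ; ′-cong        = up (E-′ _ _)
      }
      where
      ⟪_⟫ : Lift c (Term ℕ) → Carrier
      ⟪ s ⟫ = value (lower s)

    ≈⇒Mem : ∀ {x y} → x ≈ y → Mem (E x y)
    ≈⇒Mem x≈y = up (≤-reflexive (sym (E-≈𝟙 x≈y))) 𝟙∈

    -- Terms evaluate in the quotient by substitution.
    value-⟦⟧ : ∀ t (σ : ℕ → Lift c (Term ℕ)) →
      value (lower (⟦ quotient ⟧ t σ)) ≡ ⟦ A ⟧ t (λ n → value (lower (σ n)))
    value-⟦⟧ (var n)  σ = ≡.refl
    value-⟦⟧ (s ∨ᵗ t) σ = ≡.cong₂ _∨_ (value-⟦⟧ s σ) (value-⟦⟧ t σ)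
    value-⟦⟧ (s ∧ᵗ t) σ = ≡.cong₂ _∧_ (value-⟦⟧ s σ) (value-⟦⟧ t σ)
    value-⟦⟧ (s ⇒ᵗ t) σ = ≡.cong₂ _⇒_ (value-⟦⟧ s σ) (value-⟦⟧ t σ)
    value-⟦⟧ (t ′ᵗ)   σ = ≡.cong _′ (value-⟦⟧ t σ)
    value-⟦⟧ 𝟘ᵗ       σ = ≡.refl
    value-⟦⟧ 𝟙ᵗ       σ = ≡.refl

    quotient-satisfies : ∀ e → Satisfies A e → Satisfies quotient e
    quotient-satisfies (s , t) A⊨e σ = ≈⇒Mem (trans
      (reflexive (value-⟦⟧ s σ))
      (trans (A⊨e _) (reflexive (≡.sym (value-⟦⟧ t σ)))))

    quotient-JID : JID quotient
    quotient-JID = models⇒JID quotient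
      (λ e ax → quotient-satisfies e (JID⇒models A isJID e ax))

    quotient-discriminator : (∀ t → Decides F (∇ (value t))) →
                             RepresentsDiscriminator quotient discriminator
    quotient-discriminator decides =
      (λ x z → ≈⇒Mem (select-z (value (lower x)) (value (lower z)))) ,
      (λ x y z x≉y → up
        (E-greatest (′-central (E-central _ _))
          (complement-select (E-central _ _) (value (lower x)) (value (lower z))))
        (decides (biimplication (lower x) (lower y))
          (λ x≈y → contradiction x≈y x≉y)))
      where
      open PartialOrderReasoning poset

      select-z : ∀ x z → E x x ∧ z ∨ (E x x) ′ ∧ x ≈ z
      select-z x z = begin-equality
        E x x ∧ z ∨ (E x x) ′ ∧ x  ≈⟨ ∨-cong (∧-cong E≈𝟙 refl)
                                             (∧-cong (trans (′-cong E≈𝟙) 𝟙′≈𝟘) refl) ⟩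
        𝟙 ∧ z ∨ 𝟘 ∧ x              ≈⟨ ∨-cong (proj₁ ∧-identity z) (∧-zeroˡ x) ⟩
        z ∨ 𝟘                      ≈⟨ proj₂ ∨-identity z ⟩
        z                          ∎
        where
        E≈𝟙  = E-≈𝟙 (refl {x})
        𝟙′≈𝟘 = DQD.𝟙′ (JID.isDQD isJID)

-- The discriminator algebras generate JID

-- With G the equation s ≈ t at ρ, the principal filter of E(s,t)′ is proper
-- relative to G.  A maximal extension F of it gives a discriminator
-- algebra; if s and t agree there then F contains both E(s,t) and its
-- complement, so G holds.
satisfies-from-quotients :
  ∀ {c ℓ} (A : Algebra c ℓ) → JID A → ∀ e →
  (∀ (B : Algebra c ℓ) → DiscriminatorJID B → Satisfies B e) → Satisfies A e
satisfies-from-quotients A isJID (s , t) holds ρ =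
  proper (up (≤-reflexive (proj₂ (E-central x y))) (∧∈ E∈ E′∈))
  where
  x = ⟦ A ⟧ s ρ
  y = ⟦ A ⟧ t ρ

  open Algebra A using (_≈_; _′; 𝟘; isEquivalence)
  open JIDProperties A isJID
  open RelativeFilters A isJID (x ≈ y)
  open Quotient A isJID (x ≈ y) ρ
  open Lindenbaum ρ

  E′≰𝟘 : E x y ′ ≤ 𝟘 → x ≈ y
  E′≰𝟘 E′≤𝟘 = 𝟙≤E⇒≈ (≤-trans
    (≤-reflexive (IsEquivalence.sym isEquivalence (proj₁ (E-central x y))))
    (∨-least ≤-refl (≤-trans E′≤𝟘 (minimum _))))

  ultrafilter = lindenbaum (principal (E x y ′) E′≰𝟘)

  F = proj₁ ultrafilter
  open Filter F

  E′∈ : Mem (E x y ′)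
  E′∈ = proj₁ (proj₂ ultrafilter) (λ k → k ≤-refl)

  E∈ : Mem (E x y)
  E∈ = ≡.subst₂ (λ u v → Mem (E u v)) (value-⟦⟧ F s _) (value-⟦⟧ F t _)
    (holds (quotient F)
      (quotient-JID F , quotient-discriminator F (proj₂ (proj₂ ultrafilter)))
      (λ n → lift (var n)))

JID⇔generated : ∀ {c ℓ} (A : Algebra c ℓ) →
                JID A ⇔ GeneratedVariety DiscriminatorJID A
JID⇔generated A = mk⇔
  (λ isJID ℰ K⊨ℰ e e∈ℰ →
    satisfies-from-quotients A isJID e (λ B B∈K → K⊨ℰ B B∈K e e∈ℰ))
  (λ generated → models⇒JID A
    (generated JIDAxiom (λ B B∈K → JID⇒models B (proj₁ B∈K))))

corollary3p11 : (c ℓ : Level) →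
    IsDiscriminatorVariety {c} {ℓ} JID × (JID {c} {ℓ} ⊆ DQDₙ 2)
corollary3p11 c ℓ =
  (DiscriminatorJID , discriminator , (λ A → proj₂) , JID⇔generated) ,
  (λ {A} isJID → record
    { isDQD   = JID.isDQD isJID
    ; level-n = JIDProperties.level-2 A isJID
    })
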